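{- There is an exact $3$-pass catalytic streaming algorithm which counts the number of triangles of an $n$-vertex graph given as a graph stream, using $O(\log n)$ bits of (clean) space.
   Context: A graph stream is a stream whose items are the edges $(u,v)$ of a simple undirected graph $G$ on $n$ vertices, each edge appearing once, in arbitrary order. Catalytic streaming model: an algorithm has read-only access to the stream, which it scans sequentially from beginning to end, in the same order, in each pass; a workspace ("clean space") initialized to all zeros; and a catalytic memory initially containing an arbitrary string $z$. The algorithm may read and modify the catalytic memory during the computation but must restore it to exactly $z$ at the end; the output must be correct for every stream and every $z$. Clean space is measured in bits; the space of an algorithm means its clean space. Space complexity refers to storage space (memory maintained between arrivals of consecutive stream items), not to the temporary memory used while processing a single item. -}

module Defs where

open import Level using (0ℓ)
open import Data.Bool.Base using (Bool; false)
open import Data.Fin.Base using (Fin; _<_)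
open import Data.Fin.Properties using (_<?_)
open import Data.List.Base
  using (List; allFin; cartesianProduct; filter; foldl; length)
open import Data.List.Relation.Unary.All using (All)
open import Data.List.Relation.Unary.AllPairs using (AllPairs)
open import Data.List.Relation.Unary.Any using (Any)
open import Data.Nat.Base using (ℕ; _*_; _≤_)
open import Data.Nat.GeneralisedArithmetic using (fold)
open import Data.Product.Base using (_×_; _,_; ∃-syntax; proj₁; proj₂)
open import Data.Sum.Base using (_⊎_)
open import Data.Vec.Base using (Vec; replicate)
open import Relation.Binary.Core using (Rel)
open import Relation.Binary.Definitions using (Decidable; Irreflexive; Symmetric)
open import Relation.Binary.PropositionalEquality.Core using (_≡_)
open import Relation.Nullary.Decidable.Core using (_×-dec_)
open import Relation.Nullary.Negation.Core using (¬_)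
import Relation.Unary as U

------------------------------------------------------------------------
-- Simple graphs and triangles

record SimpleGraph (n : ℕ) : Set₁ where
  field
    Adj    : Rel (Fin n) 0ℓ
    adj?   : Decidable Adj
    symm   : Symmetric Adj
    irrefl : Irreflexive _≡_ Adj

module _ {n : ℕ} (G : SimpleGraph n) where
  open SimpleGraph G

  -- Ordering the vertices makes each triangle {u,v,w} count exactly once.
  IsTriangle : U.Pred (Fin n × Fin n × Fin n) 0ℓ
  IsTriangle (u , v , w) =
    (u < v) × (v < w) × Adj u v × Adj v w × Adj u w

  isTriangle? : U.Decidable IsTriangle
  isTriangle? (u , v , w) =
    (u <? v) ×-dec (v <? w) ×-dec adj? u v ×-dec adj? v w ×-dec adj? u w

  triangleCount : ℕ
  triangleCount =
    length (filter isTriangle?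
      (cartesianProduct (allFin n) (cartesianProduct (allFin n) (allFin n))))

------------------------------------------------------------------------
-- Graph streams

EdgeItem : ℕ → Set
EdgeItem n = Fin n × Fin n

SameEdge : ∀ {n} → Rel (EdgeItem n) 0ℓ
SameEdge (u , v) (x , y) = (u ≡ x × v ≡ y) ⊎ (u ≡ y × v ≡ x)

-- Each undirected edge appears exactly once, in one of its two orientations,
-- and the order of the list is unconstrained.
record IsGraphStream {n : ℕ} (G : SimpleGraph n) (σ : List (EdgeItem n)) : Set where
  open SimpleGraph G
  field
    sound    : All (λ e → Adj (proj₁ e) (proj₂ e)) σ
    complete : ∀ {u v} → Adj u v → Any (SameEdge (u , v)) σ
    once     : AllPairs (λ e f → ¬ SameEdge e f) σ

------------------------------------------------------------------------
-- Catalytic streaming algorithms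

-- The clean workspace (s bits) and the catalytic memory (c bits).
Memory : ℕ → ℕ → Set
Memory s c = Vec Bool s × Vec Bool c

-- The memory is all that persists between consecutive items: the pass number
-- and the position in the stream are known only if kept in it.  Work done while
-- processing one item is not charged, so the transitions are arbitrary functions.
-- The output is read from the clean workspace.
record CatalyticAlgorithm (Item Out : Set) (s c : ℕ) : Set where
  field
    step    : Item → Memory s c → Memory s c
    endPass : Memory s c → Memory s c
    output  : Vec Bool s → Out

module _ {Item Out : Set} {s c : ℕ} (A : CatalyticAlgorithm Item Out s c) where
  open CatalyticAlgorithm A

  runPass : List Item → Memory s c → Memory s c
  runPass σ m = endPass (foldl (λ m′ x → step x m′) m σ)

  run : (passes : ℕ) → List Item → Vec Bool c → Memory s c
  run passes σ z = fold (replicate s false , z) (runPass σ) passes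

  Computes : (passes : ℕ) → List Item → Out → Set
  Computes passes σ out = ∀ z →
    proj₂ (run passes σ z) ≡ z × output (proj₁ (run passes σ z)) ≡ out

------------------------------------------------------------------------
-- Asymptotics

infix 4 _∈O_

_∈O_ : (ℕ → ℕ) → (ℕ → ℕ) → Set
f ∈O g = ∃[ C ] ∃[ N ] ∀ n → N ≤ n → f n ≤ C * g n

{-# OPTIONS --safe #-}

-- Catalytic registers are integers modulo 2^k, and every time ℓ owns one register per pair
-- of vertices.  An edge arriving at time t changes only its registers of times ℓ > t, by 1,
-- -2 and 1 in the three passes, which restores the memory.  Hence, when the edge of time ℓ
-- arrives, a register of time ℓ holds a + x, a - x and a in the three passes, where a is its
-- initial content and x counts the edge before time ℓ.  Since
--   (a + x)(b + y) + (a - x)(b - y) - 2ab = 2xy,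
-- adding up, with weights 1, 1 and -2, the products of the two registers that close a triangle
-- with the current edge counts every triangle twice, at the last of its edges.  Modulo 2^k
-- this determines the number of triangles as soon as 2^k > 2n^3, so that k = O(log n).

module Submission where

open import Defs
open import Data.Bool.Base using (Bool; false)
open import Data.Fin.Base as Fin using (Fin; zero; suc; toℕ; fromℕ<; combine; funToFin; finToFun)
import Data.Fin.Properties as Fin
open import Data.Integer.Base using (ℤ; +_; -[1+_]; _+_; _*_; _-_; -_; 0ℤ; 1ℤ)
open import Data.Integer.DivMod using (_/ℕ_; n%ℕd<d; a≡a%ℕn+[a/ℕn]*n)
import Data.Integer.Properties as ℤ
open import Data.Integer.Tactic.RingSolver using (solve-∀)
open import Data.List.Base using (List; []; _∷_; allFin; cartesianProduct; filter; foldl; length; lookup)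
open import Data.List.Membership.Propositional.Properties using (∈-lookup)
open import Data.List.Relation.Unary.All as All using (All; []; _∷_)
open import Data.List.Relation.Unary.AllPairs as AllPairs using (AllPairs; []; _∷_)
open import Data.List.Relation.Unary.Any using (Any; here; there)
open import Data.List.Relation.Unary.Unique.Propositional using (Unique)
open import Data.List.Relation.Unary.Unique.Propositional.Properties
  using (allFin⁺; cartesianProduct⁺; filter⁺)
open import Data.Nat.Base as ℕ using (ℕ; zero; suc; NonZero; z≤n; s≤s; _≤_; _<_; _^_; ⌊_/2⌋)
import Data.Nat.DivMod as ℕ
import Data.Nat.Properties as ℕ
import Data.Nat.Tactic.RingSolver as ℕ-Solver
open import Data.Nat.Logarithm using (⌊log₂_⌋; ⌊log₂⌋-mono-≤; ⌊log₂[2^n]⌋≡n)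
open import Data.Product.Base using (Σ-syntax; _×_; _,_; proj₁; proj₂)
open import Data.Product.Function.NonDependent.Propositional using (_×-↔_)
open import Data.Sum.Base using (inj₁; inj₂)
open import Data.Vec.Base as Vec using (Vec; replicate; tabulate; _∷_; [])
import Data.Vec.Properties as Vec
open import Function.Base using (_∘_; _$_)
open import Function.Bundles using (_↔_; Inverse; Injection)
open import Function.Properties.Inverse using (↔⇒↣)
open import Function.Construct.Composition using (_↔-∘_)
open import Function.Construct.Identity using (↔-id)
open import Function.Construct.Symmetry using (↔-sym)
open import Relation.Binary.Definitions using (Decidable)
open import Relation.Binary.PropositionalEquality
  using (_≡_; _≗_; refl; sym; trans; cong; cong₂; subst; module ≡-Reasoning)
open import Relation.Nullary.Decidable.Core using (Dec; yes; no; _×-dec_; _⊎-dec_)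
open import Relation.Nullary.Negation.Core using (¬_; contradiction)

-- Congruence of integers modulo `m`, and canonical residues.

module Residues (m : ℕ) .{{_ : NonZero m}} where

  infix 4 _≈_
  infixl 6 _⊕_
  infixl 7 _⊗_

  -- The witness is the integer quotient, so compatibility with sums and products becomes a ring
  -- identity.
  record _≈_ (x y : ℤ) : Set where
    constructor _,_
    field
      quotient : ℤ
      equation : x ≡ y + quotient * + m

  ≈-reflexive : ∀ {x y} → x ≡ y → x ≈ y
  ≈-reflexive {x} refl = 0ℤ , sym (ℤ.+-identityʳ x)

  ≈-refl : ∀ {x} → x ≈ x
  ≈-refl = ≈-reflexive refl

  ≈-sym : ∀ {x y} → x ≈ y → y ≈ x
  ≈-sym {x} {y} (q , eq) =
    - q , trans (lemma y q (+ m)) (cong (_+ (- q) * + m) (sym eq))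
    where
    lemma : ∀ y q m → y ≡ (y + q * m) + (- q) * m
    lemma = solve-∀

  ≈-trans : ∀ {x y z} → x ≈ y → y ≈ z → x ≈ z
  ≈-trans {z = z} (q , refl) (r , refl) = r + q , lemma z q r (+ m)
    where
    lemma : ∀ z q r m → (z + r * m) + q * m ≡ z + (r + q) * m
    lemma = solve-∀

  _⊕_ : ∀ {x y u v} → x ≈ y → u ≈ v → x + u ≈ y + v
  _⊕_ {y = y} {v = v} (q , refl) (r , refl) = q + r , lemma y v q r (+ m)
    where
    lemma : ∀ y v q r m → (y + q * m) + (v + r * m) ≡ (y + v) + (q + r) * m
    lemma = solve-∀

  _⊗_ : ∀ {x y u v} → x ≈ y → u ≈ v → x * u ≈ y * v
  _⊗_ {y = y} {v = v} (q , refl) (r , refl) =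
    y * r + q * v + q * (r * + m) , lemma y v q r (+ m)
    where
    lemma : ∀ y v q r m →
      (y + q * m) * (v + r * m) ≡ y * v + (y * r + q * v + q * (r * m)) * m
    lemma = solve-∀

  residue : ℤ → Fin m
  residue x = fromℕ< (n%ℕd<d x m)

  value : Fin m → ℤ
  value r = + toℕ r

  value-residue : ∀ x → value (residue x) ≈ x
  value-residue x = ≈-sym
    (x /ℕ m , trans (a≡a%ℕn+[a/ℕn]*n x m)
                    (cong (λ r → + r + (x /ℕ m) * + m) (sym (Fin.toℕ-fromℕ< (n%ℕd<d x m)))))

  -- A nonnegative quotient turns the equation into one between natural numbers, where taking
  -- remainders on both sides decides it.
  remainder-unique⁺ : ∀ {r s} → r < m → s < m → ∀ q → + r ≡ + s + + q * + m → r ≡ s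
  remainder-unique⁺ {r} {s} r<m s<m q eq = begin
    r                      ≡⟨ ℕ.m<n⇒m%n≡m r<m ⟨
    r ℕ.% m                ≡⟨ cong (ℕ._% m) (ℤ.+-injective eqℕ) ⟩
    (s ℕ.+ q ℕ.* m) ℕ.% m  ≡⟨ ℕ.[m+kn]%n≡m%n s q m ⟩
    s ℕ.% m                ≡⟨ ℕ.m<n⇒m%n≡m s<m ⟩
    s                      ∎
    where
    open ≡-Reasoning
    eqℕ : + r ≡ + (s ℕ.+ q ℕ.* m)
    eqℕ = trans eq (cong (_+_ (+ s)) (sym (ℤ.pos-* q m)))

  remainder-unique : ∀ {r s} → r < m → s < m → + r ≈ + s → r ≡ s
  remainder-unique r<m s<m (+ q , eq) = remainder-unique⁺ r<m s<m q eq
  -- Exchanging the two sides negates the quotient, which makes it the positive number `suc q`.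
  remainder-unique r<m s<m r≈s@(-[1+ q ] , _) =
    sym (remainder-unique⁺ s<m r<m (suc q) (_≈_.equation (≈-sym r≈s)))

  residue-cong : ∀ {x y} → x ≈ y → residue x ≡ residue y
  residue-cong {x} {y} x≈y = Fin.toℕ-injective $
    remainder-unique (Fin.toℕ<n (residue x)) (Fin.toℕ<n (residue y))
      (≈-trans (value-residue x) (≈-trans x≈y (≈-sym (value-residue y))))

  toℕ-residue : ∀ {r} → r < m → toℕ (residue (+ r)) ≡ r
  toℕ-residue {r} r<m = remainder-unique (Fin.toℕ<n _) r<m (value-residue (+ r))

  residue-value : ∀ r → residue (value r) ≡ r
  residue-value r = Fin.toℕ-injective (toℕ-residue (Fin.toℕ<n r))

-- Bit vectors as arrays of registers modulo `2 ^ k`.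

module Array (k : ℕ) {I : Set} {N : ℕ} (index : I ↔ Fin N) where

  private
    instance
      2^k≢0 : NonZero (2 ^ k)
      2^k≢0 = ℕ.m^n≢0 2 k

  open Residues (2 ^ k)
  position : (I × Fin k) ↔ Fin (N ℕ.* k)
  position = ↔-sym Fin.*↔× ↔-∘ (index ×-↔ ↔-id (Fin k))

  open Inverse position using (to; from; strictlyInverseˡ; strictlyInverseʳ)
  module Bit = Inverse Fin.2↔Bool

  abstract

    load : Vec Bool (N ℕ.* k) → I → Fin (2 ^ k)
    load z i = funToFin (λ j → Bit.from (Vec.lookup z (to (i , j))))

    bit : (I → Fin (2 ^ k)) → I × Fin k → Bool
    bit f (i , j) = Bit.to (finToFun {2} (f i) j)

    store : (I → Fin (2 ^ k)) → Vec Bool (N ℕ.* k)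
    store f = tabulate (λ p → bit f (from p))

    funToFin-cong : ∀ {a b} {f g : Fin a → Fin b} → f ≗ g → funToFin f ≡ funToFin g
    funToFin-cong {zero}  f≗g = refl
    funToFin-cong {suc a} f≗g = cong₂ combine (f≗g zero) (funToFin-cong (f≗g ∘ suc))

    load-store : ∀ f → load (store f) ≗ f
    load-store f i = trans (funToFin-cong bitwise) (Fin.funToFin-finToFin {k} {2} (f i))
      where
      open ≡-Reasoning
      bitwise : ∀ j → Bit.from (Vec.lookup (store f) (to (i , j))) ≡ finToFun {2} (f i) j
      bitwise j = begin
        Bit.from (Vec.lookup (store f) (to (i , j)))  ≡⟨ cong Bit.from (Vec.lookup∘tabulate _ (to (i , j))) ⟩
        Bit.from (bit f (from (to (i , j))))          ≡⟨ cong (Bit.from ∘ bit f) (strictlyInverseʳ (i , j)) ⟩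
        Bit.from (bit f (i , j))                      ≡⟨ Bit.strictlyInverseʳ _ ⟩
        finToFun {2} (f i) j                          ∎

    -- This uses that the modulus is a power of two: every word of `k` bits is exactly one residue,
    -- so an arbitrary catalytic string is a valid array and is recovered bit for bit.
    store-load : ∀ z → store (load z) ≡ z
    store-load z = trans (Vec.tabulate-cong (λ p → bitwise p)) (Vec.tabulate∘lookup z)
      where
      open ≡-Reasoning
      bit-load : ∀ ij → bit (load z) ij ≡ Vec.lookup z (to ij)
      bit-load (i , j) = begin
        bit (load z) (i , j)                              ≡⟨ cong Bit.to (Fin.finToFun-funToFin _ j) ⟩
        Bit.to (Bit.from (Vec.lookup z (to (i , j))))     ≡⟨ Bit.strictlyInverseˡ _ ⟩
        Vec.lookup z (to (i , j))                         ∎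

      bitwise : ∀ p → bit (load z) (from p) ≡ Vec.lookup z p
      bitwise p = trans (bit-load (from p)) (cong (Vec.lookup z) (strictlyInverseˡ p))

    store-cong : ∀ {f g} → f ≗ g → store f ≡ store g
    store-cong f≗g = Vec.tabulate-cong λ p →
      cong (λ r → Bit.to (finToFun {2} {k} r (proj₂ (from p)))) (f≗g (proj₁ (from p)))

    load-zeros : ∀ i → load (replicate (N ℕ.* k) false) i ≡ residue 0ℤ
    load-zeros i = Fin.toℕ-injective (begin
      toℕ (load (replicate (N ℕ.* k) false) i)  ≡⟨ cong toℕ (funToFin-cong {k} bitwise) ⟩
      toℕ (funToFin {k} {2} (λ _ → zero))       ≡⟨ funToFin-zero k ⟩
      0                                         ≡⟨ toℕ-residue (ℕ.m^n>0 2 k) ⟨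
      toℕ (residue 0ℤ)                          ∎)
      where
      open ≡-Reasoning
      bitwise : ∀ j → Bit.from (Vec.lookup (replicate (N ℕ.* k) false) (to (i , j))) ≡ zero
      bitwise j rewrite Vec.lookup-replicate (to (i , j)) false = refl

      funToFin-zero : ∀ a → toℕ (funToFin {a} {2} (λ _ → zero)) ≡ 0
      funToFin-zero zero    = refl
      funToFin-zero (suc a) = trans (Fin.toℕ-combine {2} zero (funToFin {a} {2} (λ _ → zero)))
        (cong₂ ℕ._+_ (ℕ.*-zeroʳ (2 ^ a)) (funToFin-zero a))

  read : Vec Bool (N ℕ.* k) → I → ℤ
  read z i = value (load z i)

  abstract

    shift : (I → ℤ) → Vec Bool (N ℕ.* k) → Vec Bool (N ℕ.* k)
    shift d z = store (λ i → residue (read z i + d i))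

    read-shift : ∀ d z i → read (shift d z) i ≈ read z i + d i
    read-shift d z i rewrite load-store (λ j → residue (read z j + d j)) i =
      value-residue (read z i + d i)

    shift-cong : ∀ {d e} z → d ≗ e → shift d z ≡ shift e z
    shift-cong z d≗e = store-cong (λ i → cong (λ x → residue (read z i + x)) (d≗e i))

    shift-0 : ∀ z → shift (λ _ → 0ℤ) z ≡ z
    shift-0 z = trans (store-cong unchanged) (store-load z)
      where
      unchanged : ∀ i → residue (read z i + 0ℤ) ≡ load z i
      unchanged i = trans (cong residue (ℤ.+-identityʳ (read z i))) (residue-value (load z i))

    -- Reduction modulo `2 ^ k` between two additions leaves no trace, so shifts compose by adding
    -- their amounts. With `shift-0`, restoring the memory becomes a cancellation of integers.
    shift-shift : ∀ d e z → shift e (shift d z) ≡ shift (λ i → d i + e i) z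
    shift-shift d e z = store-cong λ i → residue-cong $
      ≈-trans (read-shift d z i ⊕ ≈-refl {e i}) (≈-reflexive (ℤ.+-assoc (read z i) (d i) (e i)))

-- Indicators, finite sums and cardinality bounds.

𝟙 : ∀ {P : Set} → Dec P → ℤ
𝟙 (yes _) = 1ℤ
𝟙 (no _)  = 0ℤ

𝟙-× : ∀ {P Q : Set} (p? : Dec P) (q? : Dec Q) → 𝟙 (p? ×-dec q?) ≡ 𝟙 p? * 𝟙 q?
𝟙-× (yes _) (yes _) = refl
𝟙-× (yes _) (no _)  = refl
𝟙-× (no _)  q?      = refl

𝟙-yes : ∀ {P : Set} (p? : Dec P) → P → 𝟙 p? ≡ 1ℤ
𝟙-yes (yes _) p = refl
𝟙-yes (no ¬p) p = contradiction p ¬p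

𝟙-no : ∀ {P : Set} (p? : Dec P) → ¬ P → 𝟙 p? ≡ 0ℤ
𝟙-no (yes p) ¬p = contradiction p ¬p
𝟙-no (no _)  ¬p = refl

𝟙-disjoint : ∀ {P Q : Set} (p? : Dec P) (q? : Dec Q) → ¬ (P × Q) → 𝟙 p? * 𝟙 q? ≡ 0ℤ
𝟙-disjoint (yes p) q? ¬pq = trans (ℤ.*-identityˡ (𝟙 q?)) (𝟙-no q? (λ q → ¬pq (p , q)))
𝟙-disjoint (no _)  q? ¬pq = refl

sum : ∀ {A : Set} → (A → ℤ) → List A → ℤ
sum f []       = 0ℤ
sum f (x ∷ xs) = f x + sum f xs

sum-cong : ∀ {A : Set} {f g : A → ℤ} → f ≗ g → sum f ≗ sum g
sum-cong f≗g []       = refl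
sum-cong f≗g (x ∷ xs) = cong₂ _+_ (f≗g x) (sum-cong f≗g xs)

sum-+ : ∀ {A : Set} (f g : A → ℤ) xs → sum (λ x → f x + g x) xs ≡ sum f xs + sum g xs
sum-+ f g []       = refl
sum-+ f g (x ∷ xs) = trans (cong (_+_ (f x + g x)) (sum-+ f g xs)) (lemma (f x) (g x) (sum f xs) (sum g xs))
  where
  lemma : ∀ a b c d → (a + b) + (c + d) ≡ (a + c) + (b + d)
  lemma = solve-∀

sum-* : ∀ {A : Set} c (f : A → ℤ) xs → sum (λ x → c * f x) xs ≡ c * sum f xs
sum-* c f []       = sym (ℤ.*-zeroʳ c)
sum-* c f (x ∷ xs) = trans (cong (_+_ (c * f x)) (sum-* c f xs)) (sym (ℤ.*-distribˡ-+ c (f x) (sum f xs)))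

sum-𝟙 : ∀ {A : Set} {P : A → Set} (P? : ∀ x → Dec (P x)) xs →
        sum (λ x → 𝟙 (P? x)) xs ≡ + length (filter P? xs)
sum-𝟙 P? []       = refl
sum-𝟙 P? (x ∷ xs) with P? x
... | yes _ = cong (_+_ 1ℤ) (sum-𝟙 P? xs)
... | no _  = trans (ℤ.+-identityˡ _) (sum-𝟙 P? xs)

lookup-injective : ∀ {A : Set} {xs : List A} → Unique xs → ∀ i j → lookup xs i ≡ lookup xs j → i ≡ j
lookup-injective (_ ∷ _)     zero    zero    eq = refl
lookup-injective (x∉xs ∷ _)  zero    (suc j) eq = contradiction eq (All.lookup x∉xs (∈-lookup j))
lookup-injective (x∉xs ∷ _)  (suc i) zero    eq = contradiction (sym eq) (All.lookup x∉xs (∈-lookup i))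
lookup-injective (_ ∷ uniq)  (suc i) (suc j) eq = cong suc (lookup-injective uniq i j eq)

-- On a duplicate-free list `lookup` is injective, so followed by `f` it embeds the positions of
-- `xs` into `Fin N`.
length-unique : ∀ {A : Set} {N} (f : A ↔ Fin N) {xs : List A} → Unique xs → length xs ≤ N
length-unique f {xs} uniq = Fin.injective⇒≤ {f = λ i → Inverse.to f (lookup xs i)}
  (λ {i} {j} eq → lookup-injective uniq i j (Injection.injective (↔⇒↣ f) eq))

-- Triangles as a cubic form in edge multiplicities.

module _ {n : ℕ} where

  sameEdge? : Decidable (SameEdge {n})
  sameEdge? (u , v) (x , y) =
    (u Fin.≟ x ×-dec v Fin.≟ y) ⊎-dec (u Fin.≟ y ×-dec v Fin.≟ x)

  SameEdge-refl : ∀ {e : EdgeItem n} → SameEdge e e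
  SameEdge-refl = inj₁ (refl , refl)

  SameEdge-trans : ∀ {e f g : EdgeItem n} → SameEdge e f → SameEdge f g → SameEdge e g
  SameEdge-trans (inj₁ (refl , refl)) (inj₁ (refl , refl)) = inj₁ (refl , refl)
  SameEdge-trans (inj₁ (refl , refl)) (inj₂ (refl , refl)) = inj₂ (refl , refl)
  SameEdge-trans (inj₂ (refl , refl)) (inj₁ (refl , refl)) = inj₂ (refl , refl)
  SameEdge-trans (inj₂ (refl , refl)) (inj₂ (refl , refl)) = inj₁ (refl , refl)

  SameEdge-sym : ∀ {e f : EdgeItem n} → SameEdge e f → SameEdge f e
  SameEdge-sym (inj₁ (refl , refl)) = inj₁ (refl , refl)
  SameEdge-sym (inj₂ (refl , refl)) = inj₂ (refl , refl)

  -- Edges that differ up to orientation differ as ordered pairs, of which there are `n * n`. This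
  -- bounds the arrival times, hence the levels and the clock.
  length-stream : ∀ {σ : List (EdgeItem n)} → AllPairs (λ e f → ¬ SameEdge e f) σ → length σ ≤ n ℕ.* n
  length-stream once = length-unique (↔-sym Fin.*↔×)
    (AllPairs.map (λ ≁ e≡f → ≁ (subst (SameEdge _) e≡f SameEdge-refl)) once)

  triples : List (Fin n × Fin n × Fin n)
  triples = cartesianProduct (allFin n) (cartesianProduct (allFin n) (allFin n))

  triangleCount≤n³ : ∀ G → triangleCount G ≤ n ℕ.* (n ℕ.* n)
  triangleCount≤n³ G = length-unique
    (↔-sym Fin.*↔× ↔-∘ (↔-id (Fin n) ×-↔ ↔-sym Fin.*↔×))
    (filter⁺ (isTriangle? G) (cartesianProduct⁺ (allFin⁺ n) (cartesianProduct⁺ (allFin⁺ n) (allFin⁺ n))))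

  ordered : Fin n × Fin n × Fin n → ℤ
  ordered (x , y , z) = 𝟙 (x Fin.<? y) * 𝟙 (y Fin.<? z)

  at : EdgeItem n → EdgeItem n → ℤ
  at e p = 𝟙 (sameEdge? p e)

  triangleTerm : (EdgeItem n → ℤ) → Fin n × Fin n × Fin n → ℤ
  triangleTerm X (x , y , z) = ordered (x , y , z) * (X (x , y) * (X (y , z) * X (x , z)))

  triangles : (EdgeItem n → ℤ) → ℤ
  triangles X = sum (triangleTerm X) triples

  -- The part of triangleTerm (λ p → X p + at e p) that is linear in at e.
  closingTerm : EdgeItem n → (EdgeItem n → ℤ) → Fin n × Fin n × Fin n → ℤ
  closingTerm e X (x , y , z) = ordered (x , y , z) *
    (at e (x , y) * (X (y , z) * X (x , z)) +
     X (x , y) * (at e (y , z) * X (x , z) + X (y , z) * at e (x , z)))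

  -- A quadratic form in `X`, defined for all integer values because it is evaluated on arbitrary
  -- catalytic contents. On the indicator of the earlier edges it counts the triangles that `e`
  -- completes.
  closing : EdgeItem n → (EdgeItem n → ℤ) → ℤ
  closing e X = sum (closingTerm e X) triples

  count : List (EdgeItem n) → EdgeItem n → ℤ
  count σ p = sum (λ e → at e p) σ

  triangles-cong : ∀ {X Y} → X ≗ Y → triangles X ≡ triangles Y
  triangles-cong X≗Y = sum-cong (λ (x , y , z) →
    cong (_*_ (ordered (x , y , z)))
      (cong₂ _*_ (X≗Y (x , y)) (cong₂ _*_ (X≗Y (y , z)) (X≗Y (x , z))))) triples

  -- If `e` matched both `p` and `q`, these would be the same edge. Applied to two sides of a triple
  -- `x < y < z`, this says that one edge cannot serve as two sides of a triangle.
  at-disjoint : ∀ e p q x y z → (x Fin.< y → y Fin.< z → ¬ SameEdge p q) →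
                ordered (x , y , z) * (at e p * at e q) ≡ 0ℤ
  at-disjoint e p q x y z p≁q with x Fin.<? y | y Fin.<? z
  ... | yes x<y | yes y<z = trans (ℤ.*-identityˡ _) (𝟙-disjoint (sameEdge? p e) (sameEdge? q e)
          (λ (p~e , q~e) → p≁q x<y y<z (SameEdge-trans p~e (SameEdge-sym q~e))))
  ... | yes _   | no _    = refl
  ... | no _    | _       = refl

  xy≁yz : ∀ {x y z : Fin n} → x Fin.< y → y Fin.< z → ¬ SameEdge (x , y) (y , z)
  xy≁yz x<y y<z (inj₁ (x≡y , _)) = Fin.<⇒≢ x<y x≡y
  xy≁yz x<y y<z (inj₂ (x≡z , _)) = Fin.<⇒≢ (Fin.<-trans x<y y<z) x≡z

  xy≁xz : ∀ {x y z : Fin n} → x Fin.< y → y Fin.< z → ¬ SameEdge (x , y) (x , z)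
  xy≁xz x<y y<z (inj₁ (_ , y≡z)) = Fin.<⇒≢ y<z y≡z
  xy≁xz x<y y<z (inj₂ (x≡z , _)) = Fin.<⇒≢ (Fin.<-trans x<y y<z) x≡z

  yz≁xz : ∀ {x y z : Fin n} → x Fin.< y → y Fin.< z → ¬ SameEdge (y , z) (x , z)
  yz≁xz x<y y<z (inj₁ (y≡x , _)) = Fin.<⇒≢ x<y (sym y≡x)
  yz≁xz x<y y<z (inj₂ (y≡z , _)) = Fin.<⇒≢ y<z y≡z

  triangles-0 : triangles (λ _ → 0ℤ) ≡ 0ℤ
  triangles-0 = trans (sum-cong (λ (x , y , z) → ℤ.*-zeroʳ (ordered (x , y , z))) triples)
                      (sum-* 0ℤ (λ _ → 0ℤ) triples)

  -- In the expansion of the cubic form, every term with two or three factors `at e` contains a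
  -- product that `at-disjoint` annihilates. Only the constant and the linear part remain.
  triangles-insert : ∀ e X → triangles (λ p → X p + at e p) ≡ triangles X + closing e X
  triangles-insert e X = trans (sum-cong pointwise triples) (sum-+ _ _ triples)
    where
    lemma : ∀ o a b c i j k →
      o * ((a + i) * ((b + j) * (c + k))) ≡
      (o * (a * (b * c)) + o * (i * (b * c) + a * (j * c + b * k))) +
      ((o * (i * j)) * (c + k) + (o * (i * k)) * b + (o * (j * k)) * a)
    lemma = solve-∀

    pointwise : ∀ τ → triangleTerm (λ p → X p + at e p) τ ≡ triangleTerm X τ + closingTerm e X τ
    pointwise (x , y , z) = trans (lemma o a b c i j k)
      (trans (cong (_+_ (triangleTerm X (x , y , z) + closingTerm e X (x , y , z))) overlaps) (ℤ.+-identityʳ _))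
      where
      o = ordered (x , y , z)
      a = X (x , y)
      b = X (y , z)
      c = X (x , z)
      i = at e (x , y)
      j = at e (y , z)
      k = at e (x , z)
      overlaps : ((o * (i * j)) * (c + k) + (o * (i * k)) * b) + (o * (j * k)) * a ≡ 0ℤ
      overlaps rewrite at-disjoint e (x , y) (y , z) x y z xy≁yz
                     | at-disjoint e (x , y) (x , z) x y z xy≁xz
                     | at-disjoint e (y , z) (x , z) x y z yz≁xz = refl

  -- The parallelogram law for the quadratic form `closing e`: the mixed terms in `A` and `X` cancel
  -- between the signs, and the pure `A` terms are subtracted.
  closing-second-difference : ∀ e A X →
    closing e (λ p → A p + X p) + closing e (λ p → A p - X p) + - (+ 2) * closing e A ≡
    + 2 * closing e X
  closing-second-difference e A X = begin
    closing e (λ p → A p + X p) + closing e (λ p → A p - X p) + - (+ 2) * closing e A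
      ≡⟨ cong₂ _+_ (sym (sum-+ _ _ triples)) (sym (sum-* (- (+ 2)) _ triples)) ⟩
    sum _ triples + sum _ triples
      ≡⟨ sum-+ _ _ triples ⟨
    sum _ triples
      ≡⟨ sum-cong (λ (x , y , z) →
           lemma (ordered (x , y , z)) (at e (x , y)) (at e (y , z)) (at e (x , z))
                 (A (x , y)) (A (y , z)) (A (x , z)) (X (x , y)) (X (y , z)) (X (x , z))) triples ⟩
    sum _ triples
      ≡⟨ sum-* (+ 2) _ triples ⟩
    + 2 * closing e X ∎
    where
    open ≡-Reasoning
    lemma : ∀ o i j k a b c x y z →
      (o * (i * ((b + y) * (c + z)) + (a + x) * (j * (c + z) + (b + y) * k)) +
       o * (i * ((b - y) * (c - z)) + (a - x) * (j * (c - z) + (b - y) * k))) +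
      - (+ 2) * (o * (i * (b * c) + a * (j * c + b * k))) ≡
      + 2 * (o * (i * (y * z) + x * (j * z + y * k)))
    lemma = solve-∀

  count-absent : ∀ {p} {σ} → All (λ e → ¬ SameEdge p e) σ → count σ p ≡ 0ℤ
  count-absent []           = refl
  count-absent (p≁e ∷ p≁σ) = cong₂ _+_ (𝟙-no (sameEdge? _ _) p≁e) (count-absent p≁σ)

  count-present : ∀ {p} {σ} → AllPairs (λ e f → ¬ SameEdge e f) σ → Any (SameEdge p) σ →
                  count σ p ≡ 1ℤ
  count-present (e≁σ ∷ _) (here p~e) = cong₂ _+_ (𝟙-yes (sameEdge? _ _) p~e)
    (count-absent (All.map (λ e≁f p~f → e≁f (SameEdge-trans (SameEdge-sym p~e) p~f)) e≁σ))
  count-present (e≁σ ∷ once) (there p∈σ) = cong₂ _+_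
    (𝟙-no (sameEdge? _ _) (λ p~e →
      All.lookupWith (λ e≁f p~f → e≁f (SameEdge-trans (SameEdge-sym p~e) p~f)) e≁σ p∈σ))
    (count-present once p∈σ)

  module _ (G : SimpleGraph n) where
    open SimpleGraph G

    -- The indicator of a conjunction is a product, so the cubic form on 0/1 values sums the
    -- indicators of the predicate that `triangleCount` filters by.
    triangles-adjacent : triangles (λ (u , v) → 𝟙 (adj? u v)) ≡ + triangleCount G
    triangles-adjacent = trans
      (sum-cong (λ (x , y , z) → sym (product x y z)) triples)
      (sum-𝟙 (isTriangle? G) triples)
      where
      product : ∀ x y z → 𝟙 (isTriangle? G (x , y , z)) ≡
                ordered (x , y , z) * (𝟙 (adj? x y) * (𝟙 (adj? y z) * 𝟙 (adj? x z)))
      product x y z = begin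
        𝟙 (isTriangle? G (x , y , z))
          ≡⟨ 𝟙-× (x Fin.<? y) _ ⟩
        𝟙 (x Fin.<? y) * _
          ≡⟨ cong (_*_ (𝟙 (x Fin.<? y))) (𝟙-× (y Fin.<? z) _) ⟩
        𝟙 (x Fin.<? y) * (𝟙 (y Fin.<? z) * _)
          ≡⟨ ℤ.*-assoc (𝟙 (x Fin.<? y)) (𝟙 (y Fin.<? z)) _ ⟨
        ordered (x , y , z) * _
          ≡⟨ cong (_*_ (ordered (x , y , z)))
               (trans (𝟙-× (adj? x y) _) (cong (_*_ (𝟙 (adj? x y))) (𝟙-× (adj? y z) _))) ⟩
        ordered (x , y , z) * (𝟙 (adj? x y) * (𝟙 (adj? y z) * 𝟙 (adj? x z))) ∎
        where open ≡-Reasoning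

    -- Completeness and single occurrence give the value 1 on adjacent pairs; soundness and symmetry
    -- of adjacency give 0 on all others, whatever the orientation in the stream.
    count-stream : ∀ {σ} → IsGraphStream G σ → ∀ p → count σ p ≡ 𝟙 (adj? (proj₁ p) (proj₂ p))
    count-stream {σ} stream (u , v) with adj? u v
    ... | yes uv = count-present once (complete uv)
      where open IsGraphStream stream
    ... | no ¬uv = count-absent (All.map (λ ef uv~ → ¬uv (adjacent ef uv~)) sound)
      where
      open IsGraphStream stream
      adjacent : ∀ {e} → Adj (proj₁ e) (proj₂ e) → SameEdge (u , v) e → Adj u v
      adjacent ef (inj₁ (refl , refl)) = ef
      adjacent ef (inj₂ (refl , refl)) = symm ef

-- The three-pass algorithm on words of `k` bits.

sum-≈ : ∀ {A : Set} m .{{_ : NonZero m}} → let open Residues m in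
        ∀ {f g : A → ℤ} → (∀ x → f x ≈ g x) → ∀ xs → sum f xs ≈ sum g xs
sum-≈ m f≈g []       = Residues.≈-refl m
sum-≈ m f≈g (x ∷ xs) = Residues._⊕_ m (f≈g x) (sum-≈ m f≈g xs)

-- Passes are numbered from 0: the increments are 1, -2, 1 and the weights 1, 1, -2.
increment weight : ℕ → ℤ
increment 1 = - (+ 2)
increment _ = 1ℤ
weight 2 = - (+ 2)
weight _ = 1ℤ

module Algorithm (n k : ℕ) where

  private
    instance
      2^k≢0 : NonZero (2 ^ k)
      2^k≢0 = ℕ.m^n≢0 2 k

  open Residues (2 ^ k)

  -- Register (ℓ , p) counts the occurrences of the edge p before time ℓ.
  Index : Set
  Index = Fin (2 ^ k) × EdgeItem n

  open Array k {Index} (↔-sym Fin.*↔× ↔-∘ (↔-id (Fin (2 ^ k)) ×-↔ ↔-sym Fin.*↔×))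
  module Clean = Array k (↔-id (Fin 3))

  Catalyst : Set
  Catalyst = Vec Bool ((2 ^ k ℕ.* (n ℕ.* n)) ℕ.* k)

  Workspace : Set
  Workspace = Vec Bool (3 ℕ.* k)

  level : Catalyst → Fin (2 ^ k) → EdgeItem n → ℤ
  level z ℓ p = read z (ℓ , p)

  -- The strict inequality freezes level `t` from time `t` on: when it is read, it excludes the
  -- current edge.
  arrival : ℕ → EdgeItem n → Index → ℤ
  arrival t e (ℓ , p) = 𝟙 (t ℕ.<? toℕ ℓ) * at e p

  recordEdge : ℤ → ℕ → EdgeItem n → Catalyst → Catalyst
  recordEdge a t e = shift (λ i → a * arrival t e i)

  -- A transition sees nothing but the memory, so the pass number and the clock are registers next
  -- to the accumulator.
  fields : (pass time : ℕ) → ℤ → Fin 3 → Fin (2 ^ k)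
  fields p t acc zero             = residue (+ p)
  fields p t acc (suc zero)       = residue (+ t)
  fields p t acc (suc (suc zero)) = residue acc

  -- The argument for the accumulator is any integer: only its residue is stored, while the analysis
  -- follows the unreduced sum.
  clean : (pass time : ℕ) → ℤ → Workspace
  clean p t acc = Clean.store (fields p t acc)

  passOf : Workspace → ℕ
  passOf w = toℕ (Clean.load w zero)

  timeOf : Workspace → Fin (2 ^ k)
  timeOf w = Clean.load w (suc zero)

  accumulated : Workspace → Fin (2 ^ k)
  accumulated w = Clean.load w (suc (suc zero))

  algorithm : CatalyticAlgorithm (EdgeItem n) ℕ (3 ℕ.* k) ((2 ^ k ℕ.* (n ℕ.* n)) ℕ.* k)
  algorithm = record
    { step    = λ e (w , z) →
        clean (passOf w) (suc (toℕ (timeOf w)))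
          (value (accumulated w) + weight (passOf w) * closing e (level z (timeOf w))) ,
        recordEdge (increment (passOf w)) (toℕ (timeOf w)) e z
    -- The clock restarts at 0, so that a given edge reads the same level in all passes.
    ; endPass = λ (w , z) → clean (suc (passOf w)) 0 (value (accumulated w)) , z
    -- The accumulator ends at twice the number of triangles.
    ; output  = λ w → ⌊ toℕ (accumulated w) /2⌋
    }

  open CatalyticAlgorithm algorithm

  -- Evaluation of a run on decoded states.

  clean-cong : ∀ p t {acc acc′} → acc ≈ acc′ → clean p t acc ≡ clean p t acc′
  clean-cong p t acc≈acc′ = Clean.store-cong λ where
    zero             → refl
    (suc zero)       → refl
    (suc (suc zero)) → residue-cong acc≈acc′

  passOf-clean : ∀ {p} t acc → p < 2 ^ k → passOf (clean p t acc) ≡ p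
  passOf-clean t acc p<2^k = trans (cong toℕ (Clean.load-store _ zero)) (toℕ-residue p<2^k)

  timeOf-clean : ∀ p t acc → timeOf (clean p t acc) ≡ residue (+ t)
  timeOf-clean p t acc = Clean.load-store _ (suc zero)

  accumulated-clean : ∀ p t acc → accumulated (clean p t acc) ≡ residue acc
  accumulated-clean p t acc = Clean.load-store _ (suc (suc zero))

  -- All-zero bits decode to pass 0, time 0 and sum 0, hence the numbering from 0.
  clean-initial : replicate (3 ℕ.* k) false ≡ clean 0 0 0ℤ
  clean-initial = trans (sym (Clean.store-load _)) (Clean.store-cong λ where
    zero             → Clean.load-zeros zero
    (suc zero)       → Clean.load-zeros (suc zero)
    (suc (suc zero)) → Clean.load-zeros (suc (suc zero)))

  step-clean : ∀ {p t} acc e z → p < 2 ^ k → t < 2 ^ k →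
    step e (clean p t acc , z) ≡
    (clean p (suc t) (acc + weight p * closing e (level z (residue (+ t)))) ,
     recordEdge (increment p) t e z)
  step-clean {p} {t} acc e z p<2^k t<2^k
    rewrite passOf-clean t acc p<2^k | timeOf-clean p t acc
          | accumulated-clean p t acc | toℕ-residue t<2^k =
    cong (_, recordEdge (increment p) t e z)
      (clean-cong p (suc t) (value-residue acc ⊕ ≈-refl))

  endPass-clean : ∀ {p} t acc z → p < 2 ^ k → endPass (clean p t acc , z) ≡ (clean (suc p) 0 acc , z)
  endPass-clean {p} t acc z p<2^k
    rewrite passOf-clean t acc p<2^k | accumulated-clean p t acc =
    cong (_, z) (clean-cong (suc p) 0 (value-residue acc))

  -- The unweighted sum of what one pass reads. The catalyst changes along the way, since each edge
  -- is also recorded with factor `a`.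
  readout : ℤ → ℕ → Catalyst → List (EdgeItem n) → ℤ
  readout a t z []      = 0ℤ
  readout a t z (e ∷ σ) = closing e (level z (residue (+ t))) + readout a (suc t) (recordEdge a t e z) σ

  arrivals : ℕ → List (EdgeItem n) → Index → ℤ
  arrivals t []      i = 0ℤ
  arrivals t (e ∷ σ) i = arrival t e i + arrivals (suc t) σ i

  -- Each edge arrives at a time below `2 ^ k`, so the clock is read back exactly. After the last
  -- edge it may equal `2 ^ k` and wrap to 0, which is harmless: `endPass` resets it without reading
  -- it.
  foldl-clean : ∀ σ {p} t acc z → p < 2 ^ k → t ℕ.+ length σ ≤ 2 ^ k →
    foldl (λ m e → step e m) (clean p t acc , z) σ ≡
    (clean p (t ℕ.+ length σ) (acc + weight p * readout (increment p) t z σ) ,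
     shift (λ i → increment p * arrivals t σ i) z)
  foldl-clean [] {p} t acc z p<2^k t≤2^k = cong₂ _,_
    (cong₂ (clean p) (sym (ℕ.+-identityʳ t)) (lemma acc (weight p)))
    (sym (trans (shift-cong z (λ i → ℤ.*-zeroʳ (increment p))) (shift-0 z)))
    where
    lemma : ∀ a w → a ≡ a + w * 0ℤ
    lemma = solve-∀
  foldl-clean (e ∷ σ) {p} t acc z p<2^k t+σ≤2^k
    rewrite step-clean {p} {t} acc e z p<2^k (ℕ.<-≤-trans (ℕ.m<m+n t ℕ.z<s) t+σ≤2^k)
          | foldl-clean σ {p} (suc t) (acc + weight p * closing e (level z (residue (+ t))))
              (recordEdge (increment p) t e z) p<2^k (subst (_≤ 2 ^ k) (ℕ.+-suc t (length σ)) t+σ≤2^k) =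
    cong₂ _,_
      (cong₂ (clean p) (sym (ℕ.+-suc t (length σ))) (lemma acc (weight p) _ _))
      (trans (shift-shift _ _ z) (shift-cong z (λ i →
        sym (ℤ.*-distribˡ-+ (increment p) (arrival t e i) (arrivals (suc t) σ i)))))
    where
    lemma : ∀ a w c r → (a + w * c) + w * r ≡ a + w * (c + r)
    lemma = solve-∀

  runPass-clean : ∀ σ {p} acc z → p < 2 ^ k → length σ ≤ 2 ^ k →
    runPass algorithm σ (clean p 0 acc , z) ≡
    (clean (suc p) 0 (acc + weight p * readout (increment p) 0 z σ) ,
     shift (λ i → increment p * arrivals 0 σ i) z)
  runPass-clean σ acc z p<2^k σ≤2^k = trans
    (cong endPass (foldl-clean σ 0 acc z p<2^k σ≤2^k))
    (endPass-clean (length σ) _ _ p<2^k)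

  -- What the three passes accumulate modulo `2 ^ k`.

  closing-≈ : ∀ e (X Y : EdgeItem n → ℤ) → (∀ p → X p ≈ Y p) → closing e X ≈ closing e Y
  closing-≈ e X Y X≈Y = sum-≈ (2 ^ k) (λ (x , y , z) →
    ≈-refl {ordered (x , y , z)} ⊗ (≈-refl {at e (x , y)} ⊗ (X≈Y (y , z) ⊗ X≈Y (x , z)) ⊕
              X≈Y (x , y) ⊗ (≈-refl {at e (y , z)} ⊗ X≈Y (x , z) ⊕
                             X≈Y (y , z) ⊗ ≈-refl {at e (x , z)}))) triples

  arrivals-past : ∀ {t s} σ ℓ p → toℕ ℓ ≤ t → t ≤ s → arrivals s σ (ℓ , p) ≡ 0ℤ
  arrivals-past []      ℓ p ℓ≤t t≤s = refl
  arrivals-past {t} {s} (e ∷ σ) ℓ p ℓ≤t t≤s = cong₂ _+_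
    (cong (_* at e p) (𝟙-no (s ℕ.<? toℕ ℓ) (ℕ.≤⇒≯ (ℕ.≤-trans ℓ≤t t≤s))))
    (arrivals-past σ ℓ p ℓ≤t (ℕ.m≤n⇒m≤1+n t≤s))

  read-record : ∀ a {t} e z ℓ p → t < toℕ ℓ → level (recordEdge a t e z) ℓ p ≈ level z ℓ p + a * at e p
  read-record a {t} e z ℓ p t<ℓ = ≈-trans (read-shift _ z (ℓ , p))
    (≈-reflexive (cong (λ b → level z ℓ p + a * b)
      (trans (cong (_* at e p) (𝟙-yes (t ℕ.<? toℕ ℓ) t<ℓ)) (ℤ.*-identityˡ (at e p)))))

  -- A is the initial content and X the number of occurrences before time t: at time t,
  -- level t holds A + X, A - X and A in the three passes.
  readout-total : ∀ σ t (A : Fin (2 ^ k) → EdgeItem n → ℤ) (X : EdgeItem n → ℤ) z₀ z₁ z₂ →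
    t ℕ.+ length σ ≤ 2 ^ k →
    (∀ ℓ p → t ≤ toℕ ℓ → level z₀ ℓ p ≈ A ℓ p + X p) →
    (∀ ℓ p → t ≤ toℕ ℓ → level z₁ ℓ p ≈ A ℓ p - X p + arrivals t σ (ℓ , p)) →
    (∀ ℓ p → t ≤ toℕ ℓ → level z₂ ℓ p ≈ A ℓ p - arrivals t σ (ℓ , p)) →
    readout 1ℤ t z₀ σ + readout (- (+ 2)) t z₁ σ + - (+ 2) * readout 1ℤ t z₂ σ ≈
    + 2 * (triangles (λ p → X p + count σ p) - triangles X)
  readout-total [] t A X z₀ z₁ z₂ _ _ _ _ =
    ≈-reflexive (sym (trans (cong (λ T → + 2 * (T - triangles X)) (triangles-cong (λ p → ℤ.+-identityʳ (X p))))
                            (lemma (triangles X))))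
    where
    lemma : ∀ T → + 2 * (T - T) ≡ 0ℤ
    lemma = solve-∀
  readout-total (e ∷ σ) t A X z₀ z₁ z₂ t+σ≤2^k h₀ h₁ h₂ =
    ≈-trans (≈-reflexive (regroup (C z₀) (C z₁) (C z₂) _ _ _))
      (≈-trans (now ⊕ later) (≈-reflexive total))
    where
    ℓₜ : Fin (2 ^ k)
    ℓₜ = residue (+ t)

    toℕ-ℓₜ : toℕ ℓₜ ≡ t
    toℕ-ℓₜ = toℕ-residue (ℕ.<-≤-trans (ℕ.m<m+n t ℕ.z<s) t+σ≤2^k)

    t≤ℓₜ : t ≤ toℕ ℓₜ
    t≤ℓₜ = ℕ.≤-reflexive (sym toℕ-ℓₜ)

    C : Catalyst → ℤ
    C z = closing e (level z ℓₜ)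

    regroup : ∀ a b c r s u →
      ((a + r) + (b + s)) + - (+ 2) * (c + u) ≡
      (a + b + - (+ 2) * c) + (r + s + - (+ 2) * u)
    regroup = solve-∀

    -- Level `t` has no arrivals left at time `t`, so the correction terms in `h₁` and `h₂` vanish
    -- there.
    none : ∀ p → arrivals t (e ∷ σ) (ℓₜ , p) ≡ 0ℤ
    none p = arrivals-past (e ∷ σ) ℓₜ p (ℕ.≤-reflexive toℕ-ℓₜ) ℕ.≤-refl

    now : C z₀ + C z₁ + - (+ 2) * C z₂ ≈ + 2 * closing e X
    now = ≈-trans
      (closing-≈ e (level z₀ ℓₜ) (λ p → A ℓₜ p + X p) (λ p → h₀ ℓₜ p t≤ℓₜ)
        ⊕ closing-≈ e (level z₁ ℓₜ) (λ p → A ℓₜ p - X p) (λ p → ≈-trans (h₁ ℓₜ p t≤ℓₜ)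
            (≈-reflexive (trans (cong (_+_ (A ℓₜ p - X p)) (none p)) (ℤ.+-identityʳ _))))
        ⊕ ≈-refl { - (+ 2)} ⊗ closing-≈ e (level z₂ ℓₜ) (A ℓₜ) (λ p → ≈-trans (h₂ ℓₜ p t≤ℓₜ)
            (≈-reflexive (trans (cong (λ a → A ℓₜ p - a) (none p)) (ℤ.+-identityʳ (A ℓₜ p))))))
      (≈-reflexive (closing-second-difference e (A ℓₜ) X))

    X′ : EdgeItem n → ℤ
    X′ p = X p + at e p

    first : ∀ ℓ p → t < toℕ ℓ → arrivals t (e ∷ σ) (ℓ , p) ≡ at e p + arrivals (suc t) σ (ℓ , p)
    first ℓ p t<ℓ = cong (_+ arrivals (suc t) σ (ℓ , p))
      (trans (cong (_* at e p) (𝟙-yes (t ℕ.<? toℕ ℓ) t<ℓ)) (ℤ.*-identityˡ (at e p)))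

    -- Let `r` be the arrivals still to come at a level. The second pass starts from `a + (x + r)`
    -- and has subtracted `2x`, leaving `a - x + r`; the third starts from `a - (x + r)` and has
    -- added `x`, leaving `a - r`. Recording the edge moves `i` from the coming arrivals into `x`.
    g₀ : ∀ a x i → a + x + 1ℤ * i ≡ a + (x + i)
    g₀ = solve-∀
    g₁ : ∀ a x i r → a - x + (i + r) + - (+ 2) * i ≡ a - (x + i) + r
    g₁ = solve-∀
    g₂ : ∀ a i r → a - (i + r) + 1ℤ * i ≡ a - r
    g₂ = solve-∀

    later : readout 1ℤ (suc t) (recordEdge 1ℤ t e z₀) σ +
            readout (- (+ 2)) (suc t) (recordEdge (- (+ 2)) t e z₁) σ +
            - (+ 2) * readout 1ℤ (suc t) (recordEdge 1ℤ t e z₂) σ ≈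
            + 2 * (triangles (λ p → X′ p + count σ p) - triangles X′)
    -- The induction hypothesis concerns only levels above `t`, which are exactly those that record
    -- the edge of time `t`.
    later = readout-total σ (suc t) A X′ _ _ _
      (subst (_≤ 2 ^ k) (ℕ.+-suc t (length σ)) t+σ≤2^k)
      (λ ℓ p t<ℓ → ≈-trans (read-record 1ℤ e z₀ ℓ p t<ℓ)
        (≈-trans (h₀ ℓ p (ℕ.<⇒≤ t<ℓ) ⊕ ≈-refl) (≈-reflexive (g₀ (A ℓ p) (X p) (at e p)))))
      (λ ℓ p t<ℓ → ≈-trans (read-record (- (+ 2)) e z₁ ℓ p t<ℓ)
        (≈-trans (≈-trans (h₁ ℓ p (ℕ.<⇒≤ t<ℓ))
                          (≈-reflexive (cong (_+_ (A ℓ p - X p)) (first ℓ p t<ℓ))) ⊕ ≈-refl)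
                 (≈-reflexive (g₁ (A ℓ p) (X p) (at e p) _))))
      (λ ℓ p t<ℓ → ≈-trans (read-record 1ℤ e z₂ ℓ p t<ℓ)
        (≈-trans (≈-trans (h₂ ℓ p (ℕ.<⇒≤ t<ℓ))
                          (≈-reflexive (cong (λ a → A ℓ p - a) (first ℓ p t<ℓ))) ⊕ ≈-refl)
                 (≈-reflexive (g₂ (A ℓ p) (at e p) _))))

    -- By `triangles-insert` the current contribution is twice the increase from `triangles X` to
    -- `triangles X′`, so the sum telescopes.
    total : + 2 * closing e X + + 2 * (triangles (λ p → X′ p + count σ p) - triangles X′) ≡
            + 2 * (triangles (λ p → X p + count (e ∷ σ) p) - triangles X)
    total = trans
      (cong₂ (λ U V → + 2 * closing e X + + 2 * (U - V))
        (triangles-cong (λ p → ℤ.+-assoc (X p) (at e p) (count σ p)))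
        (triangles-insert e X))
      (telescope (closing e X) (triangles (λ p → X p + count (e ∷ σ) p)) (triangles X))
      where
      telescope : ∀ c U V → + 2 * c + + 2 * (U - (V + c)) ≡ + 2 * (U - V)
      telescope = solve-∀

  -- The three bounds on `2 ^ k` make the pass numbers 0, 1, 2 readable, keep the clock exact during
  -- a pass, and make twice the triangle count its own residue.
  correct : (G : SimpleGraph n) {σ : List (EdgeItem n)} → IsGraphStream G σ →
    2 < 2 ^ k → n ℕ.* n ≤ 2 ^ k → triangleCount G ℕ.+ triangleCount G < 2 ^ k →
    Computes algorithm 3 σ (triangleCount G)
  correct G {σ} stream 2<2^k n²≤2^k 2T<2^k z = cong proj₂ final , (begin
    output (proj₁ (run algorithm 3 σ z))  ≡⟨ cong (output ∘ proj₁) final ⟩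
    output (clean 3 0 acc)                ≡⟨ cong (⌊_/2⌋ ∘ toℕ) (accumulated-clean 3 0 acc) ⟩
    ⌊ toℕ (residue acc) /2⌋               ≡⟨ cong (⌊_/2⌋ ∘ toℕ) (residue-cong acc≈2T) ⟩
    ⌊ toℕ (residue (+ (T ℕ.+ T))) /2⌋     ≡⟨ cong ⌊_/2⌋ (toℕ-residue 2T<2^k) ⟩
    ⌊ T ℕ.+ T /2⌋                         ≡⟨ ℕ.n≡⌊n+n/2⌋ T ⟨
    T                                     ∎)
    where
    open ≡-Reasoning

    T : ℕ
    T = triangleCount G

    W : Index → ℤ
    W = arrivals 0 σ

    z₁ z₂ : Catalyst
    z₁ = shift (λ i → 1ℤ * W i) z
    z₂ = shift (λ i → - (+ 2) * W i) z₁

    acc : ℤ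
    -- Left unsimplified, this is the sum that three uses of `runPass-clean` produce.
    acc = 0ℤ + 1ℤ * readout 1ℤ 0 z σ + 1ℤ * readout (- (+ 2)) 0 z₁ σ + - (+ 2) * readout 1ℤ 0 z₂ σ

    σ≤2^k : length σ ≤ 2 ^ k
    σ≤2^k = ℕ.≤-trans (length-stream (IsGraphStream.once stream)) n²≤2^k

    cancel : ∀ w → 1ℤ * w + - (+ 2) * w + 1ℤ * w ≡ 0ℤ
    cancel = solve-∀

    restored : shift (λ i → 1ℤ * W i) z₂ ≡ z
    restored = begin
      shift (λ i → 1ℤ * W i) z₂
        ≡⟨ cong (shift (λ i → 1ℤ * W i)) (shift-shift _ _ z) ⟩
      shift (λ i → 1ℤ * W i) (shift (λ i → 1ℤ * W i + - (+ 2) * W i) z)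
        ≡⟨ shift-shift _ _ z ⟩
      shift (λ i → 1ℤ * W i + - (+ 2) * W i + 1ℤ * W i) z
        ≡⟨ shift-cong z (λ i → cancel (W i)) ⟩
      shift (λ _ → 0ℤ) z
        ≡⟨ shift-0 z ⟩
      z ∎

    final : run algorithm 3 σ z ≡ (clean 3 0 acc , z)
    final = begin
      pass (pass (pass (replicate (3 ℕ.* k) false , z)))
        ≡⟨ cong (λ w → pass (pass (pass (w , z)))) clean-initial ⟩
      pass (pass (pass (clean 0 0 0ℤ , z)))
        ≡⟨ cong (pass ∘ pass) (runPass-clean σ _ z (ℕ.≤-<-trans z≤n 2<2^k) σ≤2^k) ⟩
      pass (pass (clean 1 0 _ , z₁))
        ≡⟨ cong pass (runPass-clean σ _ z₁ (ℕ.<-trans (ℕ.n<1+n 1) 2<2^k) σ≤2^k) ⟩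
      pass (clean 2 0 _ , z₂)
        ≡⟨ runPass-clean σ _ z₂ 2<2^k σ≤2^k ⟩
      (clean 3 0 acc , shift (λ i → 1ℤ * W i) z₂)
        ≡⟨ cong (clean 3 0 acc ,_) restored ⟩
      (clean 3 0 acc , z) ∎
      where
      pass : Memory (3 ℕ.* k) ((2 ^ k ℕ.* (n ℕ.* n)) ℕ.* k) → Memory (3 ℕ.* k) ((2 ^ k ℕ.* (n ℕ.* n)) ℕ.* k)
      pass = runPass algorithm σ

    -- The invariants of `readout-total` at time 0, with `A` the initial content and `X` zero, as no
    -- edge has arrived yet.
    level₀ : ∀ ℓ p → 0 ≤ toℕ ℓ → level z ℓ p ≈ level z ℓ p + 0ℤ
    level₀ ℓ p _ = ≈-reflexive (sym (ℤ.+-identityʳ (level z ℓ p)))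

    level₁ : ∀ ℓ p → 0 ≤ toℕ ℓ → level z₁ ℓ p ≈ level z ℓ p - 0ℤ + W (ℓ , p)
    level₁ ℓ p _ = ≈-trans (read-shift _ z (ℓ , p)) (≈-reflexive (lemma (level z ℓ p) (W (ℓ , p))))
      where
      lemma : ∀ a w → a + 1ℤ * w ≡ a - 0ℤ + w
      lemma = solve-∀

    level₂ : ∀ ℓ p → 0 ≤ toℕ ℓ → level z₂ ℓ p ≈ level z ℓ p - W (ℓ , p)
    level₂ ℓ p 0≤ℓ = ≈-trans (read-shift _ z₁ (ℓ , p))
      (≈-trans (level₁ ℓ p 0≤ℓ ⊕ ≈-refl { - (+ 2) * W (ℓ , p)})
               (≈-reflexive (lemma (level z ℓ p) (W (ℓ , p)))))
      where
      lemma : ∀ a w → a - 0ℤ + w + - (+ 2) * w ≡ a - w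
      lemma = solve-∀

    triangles-stream : + 2 * (triangles (λ p → 0ℤ + count σ p) - triangles {n} (λ _ → 0ℤ)) ≡ + (T ℕ.+ T)
    triangles-stream = begin
      + 2 * (triangles (λ p → 0ℤ + count σ p) - triangles {n} (λ _ → 0ℤ))
        ≡⟨ cong₂ (λ U V → + 2 * (U - V))
             (trans (triangles-cong (λ p → trans (ℤ.+-identityˡ (count σ p)) (count-stream G stream p)))
                    (triangles-adjacent G))
             (triangles-0 {n}) ⟩
      + 2 * (+ T - 0ℤ)
        ≡⟨ double (+ T) ⟩
      + T + + T
        ≡⟨ ℤ.pos-+ T T ⟨
      + (T ℕ.+ T) ∎
      where
      double : ∀ a → + 2 * (a - 0ℤ) ≡ a + a
      double = solve-∀

    acc≈2T : acc ≈ + (T ℕ.+ T)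
    acc≈2T = ≈-trans (≈-reflexive (unit (readout 1ℤ 0 z σ) (readout (- (+ 2)) 0 z₁ σ) (readout 1ℤ 0 z₂ σ)))
      (≈-trans (readout-total σ 0 (level z) (λ _ → 0ℤ) z z₁ z₂ σ≤2^k level₀ level₁ level₂)
               (≈-reflexive triangles-stream))
      where
      unit : ∀ a b c → 0ℤ + 1ℤ * a + 1ℤ * b + - (+ 2) * c ≡ a + b + - (+ 2) * c
      unit = solve-∀

-- Word size and the logarithmic space bound.

n<2^[1+⌊log₂n⌋] : ∀ n → n < 2 ^ suc ⌊log₂ n ⌋
n<2^[1+⌊log₂n⌋] n = ℕ.≰⇒> λ 2^l≤n → ℕ.1+n≰n
  (subst (_≤ ⌊log₂ n ⌋) (⌊log₂[2^n]⌋≡n (suc ⌊log₂ n ⌋)) (⌊log₂⌋-mono-≤ 2^l≤n))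

-- With `N = 2 ^ l` at least `n`, the three summands `l` provide `N³`. Of the two extra bits, one
-- pays for the doubled count and one for strictness; together they also give room for the pass
-- number when `n` is small.
wordSize : ℕ → ℕ
wordSize n = let l = suc ⌊log₂ n ⌋ in 2 ℕ.+ (l ℕ.+ (l ℕ.+ l))

2^wordSize : ∀ n → let N = 2 ^ suc ⌊log₂ n ⌋ in 2 ^ wordSize n ≡ 2 ℕ.* (2 ℕ.* (N ℕ.* (N ℕ.* N)))
2^wordSize n = cong (λ x → 2 ℕ.* (2 ℕ.* x))
  (trans (ℕ.^-distribˡ-+-* 2 l (l ℕ.+ l)) (cong (2 ^ l ℕ.*_) (ℕ.^-distribˡ-+-* 2 l l)))
  where
  l : ℕ
  l = suc ⌊log₂ n ⌋

module _ (n : ℕ) where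

  private
    N : ℕ
    N = 2 ^ suc ⌊log₂ n ⌋

    n≤N : n ≤ N
    n≤N = ℕ.<⇒≤ (n<2^[1+⌊log₂n⌋] n)

    1≤N : 1 ≤ N
    1≤N = ℕ.m^n>0 2 (suc ⌊log₂ n ⌋)

    1≤N³ : 1 ≤ N ℕ.* (N ℕ.* N)
    1≤N³ = ℕ.*-mono-≤ 1≤N (ℕ.*-mono-≤ 1≤N 1≤N)

  2<2^wordSize : 2 < 2 ^ wordSize n
  2<2^wordSize rewrite 2^wordSize n =
    ℕ.<-≤-trans (s≤s (s≤s (s≤s z≤n))) (ℕ.*-monoʳ-≤ 2 (ℕ.*-monoʳ-≤ 2 1≤N³))

  n²≤2^wordSize : n ℕ.* n ≤ 2 ^ wordSize n
  n²≤2^wordSize rewrite 2^wordSize n = begin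
    n ℕ.* n                          ≤⟨ ℕ.*-mono-≤ n≤N n≤N ⟩
    N ℕ.* N                          ≤⟨ ℕ.m≤n*m (N ℕ.* N) N {{ℕ.>-nonZero 1≤N}} ⟩
    N ℕ.* (N ℕ.* N)                  ≤⟨ ℕ.m≤n*m _ 2 ⟩
    2 ℕ.* (N ℕ.* (N ℕ.* N))          ≤⟨ ℕ.m≤n*m _ 2 ⟩
    2 ℕ.* (2 ℕ.* (N ℕ.* (N ℕ.* N)))  ∎
    where open ℕ.≤-Reasoning

  2t<2^wordSize : ∀ {t} → t ≤ n ℕ.* (n ℕ.* n) → t ℕ.+ t < 2 ^ wordSize n
  2t<2^wordSize {t} t≤n³ rewrite 2^wordSize n = begin-strict
    t ℕ.+ t                          ≡⟨ cong (t ℕ.+_) (ℕ.+-identityʳ t) ⟨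
    2 ℕ.* t                          ≤⟨ ℕ.*-monoʳ-≤ 2 t≤n³ ⟩
    2 ℕ.* (n ℕ.* (n ℕ.* n))          ≤⟨ ℕ.*-monoʳ-≤ 2 (ℕ.*-mono-≤ n≤N (ℕ.*-mono-≤ n≤N n≤N)) ⟩
    2 ℕ.* N³                         <⟨ ℕ.*-monoʳ-< 2 (ℕ.m<m*n N³ 2 {{ℕ.>-nonZero 1≤N³}} (ℕ.n<1+n 1)) ⟩
    2 ℕ.* (N³ ℕ.* 2)                 ≡⟨ cong (2 ℕ.*_) (ℕ.*-comm N³ 2) ⟩
    2 ℕ.* (2 ℕ.* N³)                 ∎
    where
    open ℕ.≤-Reasoning
    N³ : ℕ
    N³ = N ℕ.* (N ℕ.* N)

3*wordSize∈O[log] : (λ n → 3 ℕ.* wordSize n) ∈O (λ n → ⌊log₂ n ⌋)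
-- The space is `15 + 9l` with `l` the logarithm, and `15 + 9 = 24` once `l` is at least 1, that is,
-- from `n = 2` on.
3*wordSize∈O[log] = 24 , 2 , λ n 2≤n → bound (⌊log₂⌋-mono-≤ 2≤n)
  where
  open ℕ.≤-Reasoning
  expand : ∀ l → 3 ℕ.* (2 ℕ.+ (suc l ℕ.+ (suc l ℕ.+ suc l))) ≡ 15 ℕ.* 1 ℕ.+ 9 ℕ.* l
  expand = ℕ-Solver.solve-∀
  bound : ∀ {l} → 1 ≤ l → 3 ℕ.* (2 ℕ.+ (suc l ℕ.+ (suc l ℕ.+ suc l))) ≤ 24 ℕ.* l
  bound {l} 1≤l = begin
    3 ℕ.* (2 ℕ.+ (suc l ℕ.+ (suc l ℕ.+ suc l)))  ≡⟨ expand l ⟩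
    15 ℕ.* 1 ℕ.+ 9 ℕ.* l                         ≤⟨ ℕ.+-monoˡ-≤ (9 ℕ.* l) (ℕ.*-monoʳ-≤ 15 1≤l) ⟩
    15 ℕ.* l ℕ.+ 9 ℕ.* l                         ≡⟨ ℕ.*-distribʳ-+ l 15 9 ⟨
    24 ℕ.* l                                     ∎

corollary31 : Σ[ s ∈ (ℕ → ℕ) ] Σ[ c ∈ (ℕ → ℕ) ]
    Σ[ A ∈ ((n : ℕ) → CatalyticAlgorithm (EdgeItem n) ℕ (s n) (c n)) ]
    (s ∈O (λ n → ⌊log₂ n ⌋)) ×
    ((n : ℕ) (G : SimpleGraph n) (σ : List (EdgeItem n)) →
    IsGraphStream G σ → Computes (A n) 3 σ (triangleCount G))
corollary31 =
  (λ n → 3 ℕ.* wordSize n) ,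
  (λ n → (2 ^ wordSize n ℕ.* (n ℕ.* n)) ℕ.* wordSize n) ,
  (λ n → Algorithm.algorithm n (wordSize n)) ,
  3*wordSize∈O[log] ,
  λ n G σ stream → Algorithm.correct n (wordSize n) G stream
    (2<2^wordSize n) (n²≤2^wordSize n) (2t<2^wordSize n (triangleCount≤n³ G))
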